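{- Let $p\in(0,1)$ and suppose a deck of $n$ cards is shuffled once by the asymmetric single-shelf shuffle with parameter $p$. Let $m_{i,j}$ be the probability that card $i$ lands in position $j$. Then $$m_{i,j}=p^{j}(1-p)^{i-j}\binom{i-1}{j-1}+p^{\,i-1-(n-j)}(1-p)^{n-j+1}\binom{i-1}{n-j}$$ for $1\le i\le n-1$ and $1\le j\le n$, and for $i=n$ $$m_{n,j}=p^{j-1}(1-p)^{n-j}\binom{n-1}{j-1},\qquad 1\le j\le n.$$
   Context: Asymmetric single-shelf shuffle with parameter $p\in(0,1)$: an ordered deck of $n$ cards labelled $1,\dots,n$ (card $1$ on top, card $n$ at the bottom) is given. Cards are drawn one by one from the bottom of the deck (so in the order $n,n-1,\dots,1$) and put on an initially empty pile; each drawn card is placed, independently, at the top of the pile with probability $p$ and at the bottom of the pile with probability $1-p$. The final pile is the shuffled deck; positions are numbered $1,\dots,n$ from the top. Convention: $\binom{0}{0}=1$ and $\binom{a}{b}=0$ for integers $b>a\ge 0$ (exponents of $p$ and $1-p$ may be negative only where the binomial coefficient vanishes). -}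

module Defs where

open import Algebra.Apartness.Bundles using (HeytingField; HeytingCommutativeRing)
open import Algebra.Bundles using (CommutativeRing)
import Algebra.Properties.Semiring.Exp
import Algebra.Properties.Semiring.Mult
open import Data.Fin.Base using (Fin; toℕ)
open import Data.Fin.Properties using (_≟_)
open import Data.Integer.Base using (ℤ; +_; -[1+_])
open import Data.List.Base as List using (List; []; _∷_; _++_)
open import Data.Nat.Base using (ℕ; zero; suc)
open import Data.Product.Base using (proj₁)
open import Data.Sum.Base using (_⊎_)
open import Data.Vec.Base as Vec using (Vec; []; _∷_; _∷ʳ_)
open import Level using (_⊔_) renaming (suc to lsuc)
open import Relation.Binary.Core using (Rel)
open import Relation.Binary.Structures using (IsStrictPartialOrder)
open import Relation.Unary using (Pred; Decidable)

-- The library has no real numbers, so probabilities take values in an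
-- ordered field.  The order is not assumed decidable: both ℚ and the
-- (constructive or classical) real numbers are ordered fields in this sense.

record OrderedField c ℓ₁ ℓ₂ ℓ₃ : Set (lsuc (c ⊔ ℓ₁ ⊔ ℓ₂ ⊔ ℓ₃)) where
  infix 4 _<_
  field
    heytingField : HeytingField c ℓ₁ ℓ₂

  open HeytingField heytingField public

  field
    _<_                  : Rel Carrier ℓ₃
    isStrictPartialOrder : IsStrictPartialOrder _≈_ _<_
    #⇒<⊎>                : ∀ {x y} → x # y → x < y ⊎ y < x
    <⇒#                  : ∀ {x y} → x < y → x # y
    +-monoˡ-<            : ∀ {x y} z → x < y → x + z < y + z
    *-pos                : ∀ {x y} → 0# < x → 0# < y → 0# < x * y

  open HeytingCommutativeRing heytingCommutativeRing public
    using (commutativeRing)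
  open CommutativeRing commutativeRing public using (semiring)
  open Algebra.Properties.Semiring.Exp semiring public using (_^_)
  open Algebra.Properties.Semiring.Mult semiring using () renaming (_×_ to _times_)

  fromℕ : ℕ → Carrier
  fromℕ k = k times 1#

  sum : List Carrier → Carrier
  sum = List.foldr _+_ 0#

  -- `#⇒invertible` inverts x - 0# rather than x.
  inverse : (x : Carrier) → x # 0# → Carrier
  inverse x x#0 = proj₁ (#⇒invertible x#0)

  zpow : (x : Carrier) → x # 0# → ℤ → Carrier
  zpow x x#0 (+ k)    = x ^ k
  zpow x x#0 -[1+ k ] = inverse x x#0 ^ suc k

  0<⇒#0 : ∀ {x} → 0# < x → x # 0#
  0<⇒#0 0<x = #-sym (<⇒# 0<x)

  x<y⇒0<y-x : ∀ {x y} → x < y → 0# < y - x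
  x<y⇒0<y-x {x} x<y =
    IsStrictPartialOrder.<-respˡ-≈ isStrictPartialOrder
      (-‿inverseʳ x) (+-monoˡ-< (- x) x<y)

data Placement : Set where
  top bottom : Placement

put : ∀ {a} {A : Set a} {n} → Placement → A → Vec A n → Vec A (suc n)
put top    card pile = card ∷ pile
put bottom card pile = pile ∷ʳ card

-- Decks and piles are listed from top to bottom.  The head of the deck is
-- put on the pile after all the cards below it, i.e. cards are drawn from the
-- bottom of the deck.  The k-th placement is the one used for the k-th card
-- of the deck.

shuffle : ∀ {a} {A : Set a} {n} → Vec A n → Vec Placement n → Vec A n
shuffle []            []       = []
shuffle (card ∷ deck) (s ∷ ss) = put s card (shuffle deck ss)

outcomes : ∀ n → List (Vec Placement n)
outcomes zero    = [] ∷ []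
outcomes (suc n) =
  List.map (top ∷_) (outcomes n) ++ List.map (bottom ∷_) (outcomes n)

-- Cards and positions are numbered from 1.

number : ∀ {n} → Fin n → ℕ
number i = suc (toℕ i)

module SingleShelf
  {c ℓ₁ ℓ₂ ℓ₃} (F : OrderedField c ℓ₁ ℓ₂ ℓ₃)
  (p : OrderedField.Carrier F)
  (0<p : OrderedField._<_ F (OrderedField.0# F) p)
  (p<1 : OrderedField._<_ F p (OrderedField.1# F))
  where

  open OrderedField F

  q : Carrier
  q = 1# - p

  p^_ q^_ : ℤ → Carrier
  p^_ = zpow p (0<⇒#0 0<p)
  q^_ = zpow q (0<⇒#0 (x<y⇒0<y-x p<1))

  infix 9 p^_ q^_

  placementProbability : Placement → Carrier
  placementProbability top    = p
  placementProbability bottom = q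

  -- Placements are independent, hence the product.
  outcomeProbability : ∀ {n} → Vec Placement n → Carrier
  outcomeProbability []       = 1#
  outcomeProbability (s ∷ ss) = placementProbability s * outcomeProbability ss

  Pr : ∀ {n ℓ} {E : Pred (Vec Placement n) ℓ} → Decidable E → Carrier
  Pr {n} E? = sum (List.map outcomeProbability (List.filter E? (outcomes n)))

  m : ∀ {n} → Fin n → Fin n → Carrier
  m {n} i j = Pr (λ ss → Vec.lookup (shuffle (Vec.allFin n) ss) j ≟ i)

{-# OPTIONS --safe #-}

-- After card i is put on the pile, its position is 1 plus the number of top
-- placements among cards 1, …, i − 1 if it was put at the top, and its position
-- from below is 1 plus the number of bottom placements among them if it was put
-- at the bottom.  The two summands of the formula are these two binomial
-- probabilities.  For i = n the two placements of card i have the same effect,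
-- the two binomial probabilities agree, and p + (1 − p) = 1 merges them.

module Submission where

open import Defs
open import Algebra.Bundles using (CommutativeRing)
import Algebra.Properties.Semiring.Exp as Exp
import Algebra.Properties.Semiring.Mult as Mult
import Algebra.Solver.Ring.NaturalCoefficients.Default as SemiringSolver
open import Data.Bool.Base using (true; false)
open import Data.Fin.Base as Fin using (Fin; zero; suc; toℕ; inject₁; opposite)
open import Data.Fin.Properties
  using (_≟_; 0≢1+n; suc-injective; toℕ-fromℕ; toℕ-inject₁; toℕ<n; toℕ≤pred[n]; opposite-prop; opposite-suc)
open import Data.Fin.Relation.Unary.Top using (view; ‵fromℕ; ‵inject₁)
open import Data.Integer.Base using (+_; _⊖_)
open import Data.Integer.Properties using (⊖-≥; [1+m]⊖[1+n]≡m⊖n)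
open import Data.List.Base as List using (List; []; _∷_; _++_)
open import Data.List.Properties using (filter-++; filter-≐)
open import Data.Nat.Base as ℕ using (ℕ; zero; suc; _∸_; _≤_; z<s)
open import Data.Nat.Combinatorics
  using (_C_; k>n⇒nCk≡0; nCk≡nC[n∸k]; nCk+nC[k+1]≡[n+1]C[k+1])
import Data.Nat.Properties as ℕ
open import Data.Product.Base using (_×_; _,_)
open import Data.Vec.Base as Vec using (Vec; []; _∷_; _∷ʳ_; lookup; allFin; tabulate)
open import Data.Vec.Properties using (map-∷ʳ; lookup-map; tabulate-allFin)
open import Function.Base using (_∘_)
open import Relation.Binary.PropositionalEquality as ≡ using (_≡_)
import Relation.Binary.Reasoning.Setoid as SetoidReasoning
open import Relation.Nullary.Decidable using (yes; no; does)
open import Relation.Nullary.Negation using (¬_; contradiction)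
open import Relation.Unary using (Pred; Decidable; _≐_)

-- Positions counted from below, and the two ends of a pile.

opposite-fromℕ : ∀ n → opposite (Fin.fromℕ n) ≡ zero
opposite-fromℕ zero    = ≡.refl
opposite-fromℕ (suc n) = ≡.cong inject₁ (opposite-fromℕ n)

opposite-inject₁ : ∀ {n} (i : Fin n) → opposite (inject₁ i) ≡ suc (opposite i)
opposite-inject₁ zero    = ≡.refl
opposite-inject₁ (suc i) = ≡.cong inject₁ (opposite-inject₁ i)

lookup-∷ʳ-fromℕ : ∀ {a} {A : Set a} {n} (xs : Vec A n) x → lookup (xs ∷ʳ x) (Fin.fromℕ n) ≡ x
lookup-∷ʳ-fromℕ []       x = ≡.refl
lookup-∷ʳ-fromℕ (_ ∷ xs) x = lookup-∷ʳ-fromℕ xs x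

lookup-∷ʳ-inject₁ : ∀ {a} {A : Set a} {n} (xs : Vec A n) x i →
                    lookup (xs ∷ʳ x) (inject₁ i) ≡ lookup xs i
lookup-∷ʳ-inject₁ (_ ∷ xs) x zero    = ≡.refl
lookup-∷ʳ-inject₁ (_ ∷ xs) x (suc i) = lookup-∷ʳ-inject₁ xs x i

-- Relabelling the cards.

module _ {a b} {A : Set a} {B : Set b} (f : A → B) where

  map-put : ∀ {n} s x (xs : Vec A n) → put s (f x) (Vec.map f xs) ≡ Vec.map f (put s x xs)
  map-put top    x xs = ≡.refl
  map-put bottom x xs = ≡.sym (map-∷ʳ f x xs)

  map-shuffle : ∀ {n} (deck : Vec A n) ss →
                shuffle (Vec.map f deck) ss ≡ Vec.map f (shuffle deck ss)
  map-shuffle []         []       = ≡.refl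
  map-shuffle (x ∷ deck) (s ∷ ss) =
    ≡.trans (≡.cong (put s (f x)) (map-shuffle deck ss)) (map-put s x (shuffle deck ss))

-- Shuffling never inspects labels, so it commutes with relabelling. With `f = suc` this reduces the
-- cards below card 1, which form the deck `tabulate suc`, to a standard deck that is one card
-- smaller.
lookup-shuffle-tabulate : ∀ {a} {A : Set a} {n} (f : Fin n → A) ss j →
  lookup (shuffle (tabulate f) ss) j ≡ f (lookup (shuffle (allFin n) ss) j)
lookup-shuffle-tabulate {n = n} f ss j = begin
  lookup (shuffle (tabulate f) ss) j            ≡⟨ ≡.cong (λ d → lookup (shuffle d ss) j) (tabulate-allFin f) ⟩
  lookup (shuffle (Vec.map f (allFin n)) ss) j  ≡⟨ ≡.cong (λ d → lookup d j) (map-shuffle f (allFin n) ss) ⟩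
  lookup (Vec.map f (shuffle (allFin n) ss)) j  ≡⟨ lookup-map j f (shuffle (allFin n) ss) ⟩
  f (lookup (shuffle (allFin n) ss) j)          ∎
  where open ≡.≡-Reasoning

-- Binomial probabilities and their recursion.

module BinomialTerms {c ℓ₁ ℓ₂ ℓ₃} (F : OrderedField c ℓ₁ ℓ₂ ℓ₃) where

  open OrderedField F hiding (zero)
  open CommutativeRing commutativeRing using (commutativeSemiring)
  open Exp semiring using (^-congʳ)
  open Mult semiring using (×-homo-+)
  open SemiringSolver commutativeSemiring using (solve; _:=_; _:+_; _:*_; con)
  open SetoidReasoning setoid

  -- For `x + y ≈ 1#`, the probability of `a` successes in `k` independent trials. Truncated
  -- subtraction is harmless: for `a > k` the coefficient is 0.
  binomialTerm : Carrier → Carrier → ℕ → ℕ → Carrier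
  binomialTerm x y k a = x ^ a * y ^ (k ∸ a) * fromℕ (k C a)

  -- Padding with 0 lets the recursion in the number of trials cover `a = 0` as well.
  shift : (ℕ → Carrier) → ℕ → Carrier
  shift f zero    = 0#
  shift f (suc a) = f a

  *-fromℕ-0 : ∀ z {r} → r ≡ 0 → z * fromℕ r ≈ 0#
  *-fromℕ-0 z ≡.refl = zeroʳ z

  binomialTerm-vanishes : ∀ x y {k a} → k ℕ.< a → binomialTerm x y k a ≈ 0#
  binomialTerm-vanishes x y k<a = *-fromℕ-0 _ (k>n⇒nCk≡0 k<a)

  binomialTerm-0-0 : ∀ x y → binomialTerm x y 0 0 ≈ 1#
  binomialTerm-0-0 x y =
    solve 0 (con 1 :* con 1 :* (con 1 :+ con 0) := con 1) refl

  -- For `a < k` one factor `y` splits off. Otherwise both truncated differences are 0 and the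
  -- powers disagree, but the coefficient vanishes.
  ^-∸-fromℕ-C : ∀ y k a →
    y ^ (k ∸ a) * fromℕ (k C suc a) ≈ y * y ^ (k ∸ suc a) * fromℕ (k C suc a)
  ^-∸-fromℕ-C y k a with a ℕ.<? k
  ... | yes a<k = *-congʳ (^-congʳ y (ℕ.+-∸-assoc 1 a<k))
  ... | no  a≮k = trans (*-fromℕ-0 _ kC[1+a]≡0) (sym (*-fromℕ-0 _ kC[1+a]≡0))
    where kC[1+a]≡0 = k>n⇒nCk≡0 (ℕ.s≤s (ℕ.≮⇒≥ a≮k))

  -- Pascal's rule: one further trial either succeeds, with weight `x`, or fails, with weight `y`.
  binomialTerm-suc : ∀ x y k a →
    binomialTerm x y (suc k) a ≈ x * shift (binomialTerm x y k) a + y * binomialTerm x y k a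
  binomialTerm-suc x y k zero =
    solve 3 (λ x y z → con 1 :* (y :* z) :* (con 1 :+ con 0)
                       := x :* con 0 :+ y :* (con 1 :* z :* (con 1 :+ con 0)))
      refl x y (y ^ k)
  binomialTerm-suc x y k (suc a) = begin
    x * x ^ a * y ^ (k ∸ a) * fromℕ (suc k C suc a)
      ≡⟨ ≡.cong (λ r → x * x ^ a * y ^ (k ∸ a) * fromℕ r) (nCk+nC[k+1]≡[n+1]C[k+1] k a) ⟨
    x * x ^ a * y ^ (k ∸ a) * fromℕ (k C a ℕ.+ k C suc a)
      ≈⟨ *-congˡ (×-homo-+ 1# (k C a) (k C suc a)) ⟩
    x * x ^ a * y ^ (k ∸ a) * (fromℕ (k C a) + fromℕ (k C suc a))
      ≈⟨ solve 5 (λ x u v c d → x :* u :* v :* (c :+ d)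
                                := x :* (u :* v :* c) :+ x :* u :* (v :* d))
           refl x (x ^ a) (y ^ (k ∸ a)) (fromℕ (k C a)) (fromℕ (k C suc a)) ⟩
    x * binomialTerm x y k a + x * x ^ a * (y ^ (k ∸ a) * fromℕ (k C suc a))
      ≈⟨ +-congˡ (*-congˡ (^-∸-fromℕ-C y k a)) ⟩
    x * binomialTerm x y k a + x * x ^ a * (y * y ^ (k ∸ suc a) * fromℕ (k C suc a))
      ≈⟨ +-congˡ (solve 4 (λ u y w d → u :* (y :* w :* d) := y :* (u :* w :* d))
           refl (x * x ^ a) y (y ^ (k ∸ suc a)) (fromℕ (k C suc a))) ⟩
    x * binomialTerm x y k a + y * binomialTerm x y k (suc a) ∎

  binomialTerm-swap : ∀ x y {k a} → a ≤ k → binomialTerm x y k (k ∸ a) ≈ binomialTerm y x k a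
  binomialTerm-swap x y {k} {a} a≤k = begin
    x ^ (k ∸ a) * y ^ (k ∸ (k ∸ a)) * fromℕ (k C (k ∸ a))
      ≡⟨ ≡.cong₂ (λ b r → x ^ (k ∸ a) * y ^ b * fromℕ r) (ℕ.m∸[m∸n]≡n a≤k) (≡.sym (nCk≡nC[n∸k] a≤k)) ⟩
    x ^ (k ∸ a) * y ^ a * fromℕ (k C a)
      ≈⟨ *-congʳ (*-comm _ _) ⟩
    y ^ a * x ^ (k ∸ a) * fromℕ (k C a) ∎

  -- The integer exponent is negative only for `a > k`, where the coefficient is 0; so the inverse
  -- of `y` never contributes.
  zpow-⊖-fromℕ-C : ∀ y y#0 k a →
    zpow y y#0 (k ⊖ a) * fromℕ (k C a) ≈ y ^ (k ∸ a) * fromℕ (k C a)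
  zpow-⊖-fromℕ-C y y#0 k a with a ℕ.≤? k
  ... | yes a≤k = *-congʳ (reflexive (≡.cong (zpow y y#0) (⊖-≥ a≤k)))
  ... | no  a≰k = trans (*-fromℕ-0 _ kCa≡0) (sym (*-fromℕ-0 _ kCa≡0))
    where kCa≡0 = k>n⇒nCk≡0 (ℕ.≰⇒> a≰k)

module CardPosition
  {c ℓ₁ ℓ₂ ℓ₃} (F : OrderedField c ℓ₁ ℓ₂ ℓ₃)
  (p : OrderedField.Carrier F)
  (0<p : OrderedField._<_ F (OrderedField.0# F) p)
  (p<1 : OrderedField._<_ F p (OrderedField.1# F))
  where

  open OrderedField F hiding (zero)
  open SingleShelf F p 0<p p<1
  open BinomialTerms F
  open CommutativeRing commutativeRing using (commutativeSemiring)
  open SemiringSolver commutativeSemiring using (solve; _:=_; _:+_; _:*_)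
  open SetoidReasoning setoid

  -- Probabilities of events on placement sequences.

  p+q≈1 : p + q ≈ 1#
  p+q≈1 = begin
    p + (1# - p)    ≈⟨ +-comm p (1# - p) ⟩
    1# - p + p      ≈⟨ +-assoc 1# (- p) p ⟩
    1# + (- p + p)  ≈⟨ +-congˡ (-‿inverseˡ p) ⟩
    1# + 0#         ≈⟨ +-identityʳ 1# ⟩
    1#              ∎

  p*0+q*0 : ∀ {x y} → x ≈ 0# → y ≈ 0# → p * x + q * y ≈ 0#
  p*0+q*0 {x} {y} x≈0 y≈0 = begin
    p * x + q * y    ≈⟨ +-cong (*-congˡ x≈0) (*-congˡ y≈0) ⟩
    p * 0# + q * 0#  ≈⟨ +-cong (zeroʳ p) (zeroʳ q) ⟩
    0# + 0#          ≈⟨ +-identityʳ 0# ⟩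
    0#               ∎

  weight : ∀ {n} → List (Vec Placement n) → Carrier
  weight = sum ∘ List.map outcomeProbability

  weight-++ : ∀ {n} (xs ys : List (Vec Placement n)) → weight (xs ++ ys) ≈ weight xs + weight ys
  weight-++ []       ys = sym (+-identityˡ _)
  weight-++ (x ∷ xs) ys = trans (+-congˡ (weight-++ xs ys)) (sym (+-assoc _ _ _))

  weight-filter-map : ∀ {n ℓ} {E : Pred (Vec Placement (suc n)) ℓ} (E? : Decidable E) s xs →
    weight (List.filter E? (List.map (s ∷_) xs)) ≈
    placementProbability s * weight (List.filter (E? ∘ (s ∷_)) xs)
  weight-filter-map E? s []       = sym (zeroʳ _)
  weight-filter-map E? s (x ∷ xs) with does (E? (s ∷ x))
  ... | true  = trans (+-congˡ (weight-filter-map E? s xs)) (sym (distribˡ _ _ _))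
  ... | false = weight-filter-map E? s xs

  -- Law of total probability, conditioning on the placement of card 1, the last card drawn. All
  -- later inductions rest on it.
  Pr-suc : ∀ {n ℓ} {E : Pred (Vec Placement (suc n)) ℓ} (E? : Decidable E) →
    Pr E? ≈ p * Pr (E? ∘ (top ∷_)) + q * Pr (E? ∘ (bottom ∷_))
  Pr-suc {n} E? = begin
    weight (List.filter E? (tops ++ bottoms))
      ≡⟨ ≡.cong weight (filter-++ E? tops bottoms) ⟩
    weight (List.filter E? tops ++ List.filter E? bottoms)
      ≈⟨ weight-++ (List.filter E? tops) _ ⟩
    weight (List.filter E? tops) + weight (List.filter E? bottoms)
      ≈⟨ +-cong (weight-filter-map E? top (outcomes n)) (weight-filter-map E? bottom (outcomes n)) ⟩
    p * Pr (E? ∘ (top ∷_)) + q * Pr (E? ∘ (bottom ∷_)) ∎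
    where
    tops    = List.map (top ∷_) (outcomes n)
    bottoms = List.map (bottom ∷_) (outcomes n)

  Pr-cong : ∀ {n ℓ ℓ′} {E : Pred (Vec Placement n) ℓ} {E′ : Pred (Vec Placement n) ℓ′}
    (E? : Decidable E) (E′? : Decidable E′) → E ≐ E′ → Pr E? ≈ Pr E′?
  Pr-cong {n} E? E′? E≐E′ = reflexive (≡.cong weight (filter-≐ E? E′? E≐E′ (outcomes n)))

  Pr-impossible : ∀ {n ℓ} {E : Pred (Vec Placement n) ℓ} (E? : Decidable E) →
    (∀ ss → ¬ E ss) → Pr E? ≈ 0#
  Pr-impossible {zero} E? ¬E with E? []
  ... | yes e = contradiction e (¬E [])
  ... | no  _ = refl
  Pr-impossible {suc n} E? ¬E = trans (Pr-suc E?)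
    (p*0+q*0 (Pr-impossible (E? ∘ (top ∷_)) (¬E ∘ (top ∷_)))
             (Pr-impossible (E? ∘ (bottom ∷_)) (¬E ∘ (bottom ∷_))))

  Pr-certain : ∀ {n ℓ} {E : Pred (Vec Placement n) ℓ} (E? : Decidable E) →
    (∀ ss → E ss) → Pr E? ≈ 1#
  Pr-certain {zero} E? e with E? []
  ... | yes _ = +-identityʳ 1#
  ... | no ¬e = contradiction (e []) ¬e
  Pr-certain {suc n} E? e = begin
    Pr E?
      ≈⟨ Pr-suc E? ⟩
    p * Pr (E? ∘ (top ∷_)) + q * Pr (E? ∘ (bottom ∷_))
      ≈⟨ +-cong (*-congˡ (Pr-certain (E? ∘ (top ∷_)) (e ∘ (top ∷_))))
                (*-congˡ (Pr-certain (E? ∘ (bottom ∷_)) (e ∘ (bottom ∷_)))) ⟩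
    p * 1# + q * 1#
      ≈⟨ +-cong (*-identityʳ p) (*-identityʳ q) ⟩
    p + q
      ≈⟨ p+q≈1 ⟩
    1# ∎

  -- Conditioning on the placement of card 1, and induction over the cards.

  lands? : ∀ {n} (i j : Fin n) → Decidable (λ ss → lookup (shuffle (allFin n) ss) j ≡ i)
  lands? {n} i j ss = lookup (shuffle (allFin n) ss) j ≟ i

  -- The conditional probability given that card 1 is placed by `s`. Independence lets it be taken
  -- over the other placements alone, without a division.
  mAfter : ∀ {n} → Placement → Fin (suc n) → Fin (suc n) → Carrier
  mAfter s i j = Pr (lands? i j ∘ (s ∷_))

  B : ℕ → ℕ → Carrier
  B = binomialTerm p q

  B′ : ℕ → ℕ → Carrier
  B′ = binomialTerm q p

  -- Card 1 is put last, so its place is certain; `B 0` is the indicator of index 0.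
  mAfter-top-zero : ∀ {n} (j : Fin (suc n)) → mAfter top zero j ≈ B 0 (toℕ j)
  mAfter-top-zero {n} zero = trans
    (Pr-certain {n} (lands? zero zero ∘ (top ∷_)) (λ _ → ≡.refl))
    (sym (binomialTerm-0-0 p q))
  mAfter-top-zero {suc _} (suc j) = trans
    (Pr-impossible (lands? zero (suc j) ∘ (top ∷_))
      (λ ss eq → 0≢1+n (≡.trans (≡.sym eq) (lookup-shuffle-tabulate suc ss j))))
    (sym (binomialTerm-vanishes p q (z<s {toℕ j})))

  mAfter-bottom-zero : ∀ {n} (j : Fin (suc n)) → mAfter bottom zero j ≈ B′ 0 (toℕ (opposite j))
  mAfter-bottom-zero {n} j with view j
  ... | ‵fromℕ rewrite opposite-fromℕ n = trans
    (Pr-certain (lands? zero (Fin.fromℕ n) ∘ (bottom ∷_))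
      (λ ss → lookup-∷ʳ-fromℕ (shuffle (tabulate suc) ss) zero))
    (sym (binomialTerm-0-0 q p))
  ... | ‵inject₁ j rewrite opposite-inject₁ j = trans
    (Pr-impossible (lands? zero (inject₁ j) ∘ (bottom ∷_))
      (λ ss eq → 0≢1+n (≡.trans (≡.sym eq)
        (≡.trans (lookup-∷ʳ-inject₁ (shuffle (tabulate suc) ss) zero j)
                 (lookup-shuffle-tabulate suc ss j)))))
    (sym (binomialTerm-vanishes q p (z<s {toℕ (opposite j)})))

  mAfter-top-suc-zero : ∀ {n} (i : Fin n) → mAfter top (suc i) zero ≈ 0#
  mAfter-top-suc-zero i = Pr-impossible (lands? (suc i) zero ∘ (top ∷_)) (λ _ → 0≢1+n)

  mAfter-top-suc-suc : ∀ {n} (i j : Fin n) → mAfter top (suc i) (suc j) ≈ m i j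
  mAfter-top-suc-suc i j = Pr-cong (lands? (suc i) (suc j) ∘ (top ∷_)) (lands? i j)
    ( (λ {ss} eq → suc-injective (≡.trans (≡.sym (lookup-shuffle-tabulate suc ss j)) eq))
    , (λ {ss} eq → ≡.trans (lookup-shuffle-tabulate suc ss j) (≡.cong suc eq)) )

  mAfter-bottom-suc-fromℕ : ∀ {n} (i : Fin n) → mAfter bottom (suc i) (Fin.fromℕ n) ≈ 0#
  mAfter-bottom-suc-fromℕ {n} i =
    Pr-impossible (lands? (suc i) (Fin.fromℕ n) ∘ (bottom ∷_))
      (λ ss eq → 0≢1+n (≡.trans (≡.sym (lookup-∷ʳ-fromℕ (shuffle (tabulate suc) ss) zero)) eq))

  mAfter-bottom-suc-inject₁ : ∀ {n} (i j : Fin n) → mAfter bottom (suc i) (inject₁ j) ≈ m i j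
  mAfter-bottom-suc-inject₁ i j =
    Pr-cong (lands? (suc i) (inject₁ j) ∘ (bottom ∷_)) (lands? i j)
      ( (λ {ss} eq → suc-injective (≡.trans (≡.sym (lookup-eq ss)) eq))
      , (λ {ss} eq → ≡.trans (lookup-eq ss) (≡.cong suc eq)) )
    where
    lookup-eq : ∀ ss → lookup (shuffle (tabulate suc) ss ∷ʳ zero) (inject₁ j) ≡
                       suc (lookup (shuffle (allFin _) ss) j)
    lookup-eq ss = ≡.trans (lookup-∷ʳ-inject₁ (shuffle (tabulate suc) ss) zero j)
                           (lookup-shuffle-tabulate suc ss j)

  -- The summands separate the two placements of card `i` itself: `B` counts top placements among
  -- the cards above it in the deck, `B′` bottom placements. The signature stands ahead of the proof
  -- because the next two lemmas supply the induction step and call it for the smaller deck.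
  m≈binomialTerms : ∀ {n} (i j : Fin n) →
    m i j ≈ p * B (toℕ i) (toℕ j) + q * B′ (toℕ i) (toℕ (opposite j))

  -- Card 1 on top pushes every other card down by one and keeps its position from below, so only
  -- the first summand is shifted.
  mAfter-top-suc : ∀ {n} (i : Fin n) j →
    mAfter top (suc i) j ≈
    p * shift (B (toℕ i)) (toℕ j) + q * B′ (toℕ i) (toℕ (opposite j))
  mAfter-top-suc {n} i zero rewrite toℕ-fromℕ n = trans
    (mAfter-top-suc-zero i)
    -- The top place belongs to card 1. Its index from below is `n`, more than the `toℕ i` trials,
    -- so the second summand vanishes too.
    (sym (p*0+q*0 refl (binomialTerm-vanishes q p (toℕ<n i))))
  mAfter-top-suc i (suc j) rewrite opposite-suc j =
    trans (mAfter-top-suc-suc i j) (m≈binomialTerms i j)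

  -- Mirror image: card 1 at the bottom keeps positions from the top and raises those from below by
  -- one.
  mAfter-bottom-suc : ∀ {n} (i : Fin n) j →
    mAfter bottom (suc i) j ≈
    p * B (toℕ i) (toℕ j) + q * shift (B′ (toℕ i)) (toℕ (opposite j))
  mAfter-bottom-suc {n} i j with view j
  ... | ‵fromℕ rewrite opposite-fromℕ n | toℕ-fromℕ n = trans
    (mAfter-bottom-suc-fromℕ i)
    (sym (p*0+q*0 (binomialTerm-vanishes p q (toℕ<n i)) refl))
  ... | ‵inject₁ j rewrite opposite-inject₁ j | toℕ-inject₁ j =
    trans (mAfter-bottom-suc-inject₁ i j) (m≈binomialTerms i j)

  m≈binomialTerms zero j = trans (Pr-suc (lands? zero j))
    (+-cong (*-congˡ (mAfter-top-zero j)) (*-congˡ (mAfter-bottom-zero j)))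
  m≈binomialTerms (suc i) j = begin
    m (suc i) j
      ≈⟨ Pr-suc (lands? (suc i) j) ⟩
    p * mAfter top (suc i) j + q * mAfter bottom (suc i) j
      ≈⟨ +-cong (*-congˡ (mAfter-top-suc i j)) (*-congˡ (mAfter-bottom-suc i j)) ⟩
    p * (p * shift (B k) a + q * B′ k b) + q * (p * B k a + q * shift (B′ k) b)
      -- The sum was split by the placement of card 1. Exchanging the two mixed `p * q` terms splits
      -- it by the placement of card `suc i` instead, and each bracket becomes an instance of the
      -- binomial recursion.
      ≈⟨ solve 6 (λ p q s t u v →
             p :* (p :* s :+ q :* v) :+ q :* (p :* u :+ q :* t)
             := p :* (p :* s :+ q :* u) :+ q :* (q :* t :+ p :* v))
           refl p q (shift (B k) a) (shift (B′ k) b) (B k a) (B′ k b) ⟩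
    p * (p * shift (B k) a + q * B k a) + q * (q * shift (B′ k) b + p * B′ k b)
      ≈⟨ +-cong (*-congˡ (binomialTerm-suc p q k a)) (*-congˡ (binomialTerm-suc q p k b)) ⟨
    p * B (suc k) a + q * B′ (suc k) b ∎
    where
    k = toℕ i
    a = toℕ j
    b = toℕ (opposite j)

  -- Passage to the exponents of the stated formulas.

  p*B : ∀ k a → p * B k a ≈ p^ (+ suc a) * q^ (suc k ⊖ suc a) * fromℕ (k C a)
  p*B k a rewrite [1+m]⊖[1+n]≡m⊖n k a = begin
    p * (p ^ a * q ^ (k ∸ a) * fromℕ (k C a))
      ≈⟨ solve 4 (λ p u v w → p :* (u :* v :* w) := p :* u :* (v :* w))
           refl p (p ^ a) (q ^ (k ∸ a)) (fromℕ (k C a)) ⟩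
    p * p ^ a * (q ^ (k ∸ a) * fromℕ (k C a))
      ≈⟨ *-congˡ (zpow-⊖-fromℕ-C q _ k a) ⟨
    p * p ^ a * (q^ (k ⊖ a) * fromℕ (k C a))
      ≈⟨ *-assoc _ _ _ ⟨
    p * p ^ a * q^ (k ⊖ a) * fromℕ (k C a) ∎

  q*B′ : ∀ k b → q * B′ k b ≈ p^ (k ⊖ b) * q^ (+ (b ℕ.+ 1)) * fromℕ (k C b)
  q*B′ k b rewrite ℕ.+-comm b 1 = begin
    q * (q ^ b * p ^ (k ∸ b) * fromℕ (k C b))
      ≈⟨ solve 4 (λ q u v w → q :* (u :* v :* w) := q :* u :* (v :* w))
           refl q (q ^ b) (p ^ (k ∸ b)) (fromℕ (k C b)) ⟩
    q * q ^ b * (p ^ (k ∸ b) * fromℕ (k C b))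
      ≈⟨ *-congˡ (zpow-⊖-fromℕ-C p _ k b) ⟨
    q * q ^ b * (p^ (k ⊖ b) * fromℕ (k C b))
      ≈⟨ solve 3 (λ u v w → u :* (v :* w) := v :* u :* w)
           refl (q * q ^ b) (p^ (k ⊖ b)) (fromℕ (k C b)) ⟩
    p^ (k ⊖ b) * (q * q ^ b) * fromℕ (k C b) ∎

  m-formula : ∀ {n} (card position : Fin n) →
    let i = number card
        j = number position in
    m card position ≈
      p^ (+ j) * q^ (i ⊖ j) * fromℕ ((i ∸ 1) C (j ∸ 1))
      + p^ ((i ∸ 1) ⊖ (n ∸ j)) * q^ (+ (n ∸ j ℕ.+ 1)) * fromℕ ((i ∸ 1) C (n ∸ j))
  m-formula {n} i j = begin
    m i j
      ≈⟨ m≈binomialTerms i j ⟩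
    p * B (toℕ i) (toℕ j) + q * B′ (toℕ i) (toℕ (opposite j))
      -- The index from below, counted from 0, is `n` minus the position counted from 1.
      ≡⟨ ≡.cong (λ b → p * B (toℕ i) (toℕ j) + q * B′ (toℕ i) b) (opposite-prop j) ⟩
    p * B (toℕ i) (toℕ j) + q * B′ (toℕ i) (n ∸ number j)
      ≈⟨ +-cong (p*B (toℕ i) (toℕ j)) (q*B′ (toℕ i) (n ∸ number j)) ⟩
    _ ∎

  m-last-formula : ∀ {n} (card position : Fin n) →
    let j = number position in
    number card ≡ n →
    m card position ≈
      p^ (+ (j ∸ 1)) * q^ (+ (n ∸ j)) * fromℕ ((n ∸ 1) C (j ∸ 1))
  m-last-formula {suc n} i j i≡n = begin
    m i j
      ≈⟨ m≈binomialTerms i j ⟩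
    p * B (toℕ i) a + q * B′ (toℕ i) (toℕ (opposite j))
      ≡⟨ ≡.cong₂ (λ k b → p * B k a + q * B′ k b) (ℕ.suc-injective i≡n) (opposite-prop j) ⟩
    p * B n a + q * B′ n (n ∸ a)
      -- All `n` other cards are put after the last one, so `n ∸ a` bottom placements among them
      -- mean exactly `a` top placements.
      ≈⟨ +-congˡ (*-congˡ (binomialTerm-swap q p (toℕ≤pred[n] j))) ⟩
    p * B n a + q * B n a
      ≈⟨ distribʳ (B n a) p q ⟨
    (p + q) * B n a
      ≈⟨ *-congʳ p+q≈1 ⟩
    1# * B n a
      ≈⟨ *-identityˡ (B n a) ⟩
    B n a ∎
    where a = toℕ j

proposition2 : ∀ {c ℓ₁ ℓ₂ ℓ₃} (F : OrderedField c ℓ₁ ℓ₂ ℓ₃) →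
    let open OrderedField F in
    (p : Carrier) (0<p : 0# < p) (p<1 : p < 1#) →
    let open SingleShelf F p 0<p p<1 in
    (n : ℕ) →
    ((card position : Fin n) →
    let i = number card
        j = number position in
    i ≤ n ∸ 1 →
    m card position ≈
    p^ (+ j) * q^ (i ⊖ j) * fromℕ ((i ∸ 1) C (j ∸ 1))
    + p^ ((i ∸ 1) ⊖ (n ∸ j)) * q^ (+ (n ∸ j ℕ.+ 1)) * fromℕ ((i ∸ 1) C (n ∸ j)))
    ×
    ((card position : Fin n) →
    let i = number card
        j = number position in
    i ≡ n →
    m card position ≈
    p^ (+ (j ∸ 1)) * q^ (+ (n ∸ j)) * fromℕ ((n ∸ 1) C (j ∸ 1)))
proposition2 F p 0<p p<1 n =
  (λ card position _ → m-formula card position) , m-last-formula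
  where open CardPosition F p 0<p p<1
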